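{- Let $G_1$ be a group and $k\ge1$ an integer such that $|G_1:C_{G_1}(a)|\le k$ for every $a\in G_1$. Let $n,m\ge0$, let $G\le G_1^n$ be a subgroup, let $w(\bar x,\bar y)$ be a group word in the variables $\bar x=(x_1,\dots,x_n)$, $\bar y=(y_1,\dots,y_m)$ and their inverses, and let $\bar g\in G_1^m$, $c\in G_1$. If the set $\{\bar h\in G:w(\bar h,\bar g)=c\}$ is $2k^{n^2+mn}$-large in $G$, then $w(\bar h,\bar g)=c$ for all $\bar h\in G$.
   Context: A subset $X\subseteq G$ is $k$-large in $G$ if the intersection of any $k$ left translates $\bar a_1X\cap\dots\cap\bar a_kX$ ($\bar a_i\in G$) is non-empty. -}

module Defs where

open import Algebra.Bundles using (Group)
import Algebra.Construct.Pointwise as Pointwise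
open import Data.Fin using (Fin)
open import Data.Fin.Properties using (pigeonhole; <⇒≢)
open import Data.List using (List; foldr)
open import Data.Nat using (ℕ; suc)
open import Data.Nat.Properties using (n<1+n)
open import Data.Product using (_×_; _,_; proj₁; proj₂; ∃; ∃₂)
open import Data.Sign using (Sign)
open import Data.Sum using (_⊎_; [_,_])
open import Level using (Level; _⊔_)
open import Relation.Binary.Definitions using (_Respects_)
open import Relation.Binary.PropositionalEquality as ≡ using (_≢_; subst)
open import Relation.Unary using (Pred; _∈_)

module _ {c ℓ : Level} (G : Group c ℓ) where
  open Group G

  record IsSubgroup {p} (H : Pred Carrier p) : Set (c ⊔ ℓ ⊔ p) where
    field
      respects  : H Respects _≈_
      ε-closed  : ε ∈ H
      ∙-closed  : ∀ {x y} → x ∈ H → y ∈ H → x ∙ y ∈ H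
      ⁻¹-closed : ∀ {x} → x ∈ H → x ⁻¹ ∈ H

  Centralizer : Carrier → Pred Carrier ℓ
  Centralizer a x = x ∙ a ≈ a ∙ x

  -- x H = y H, for a subgroup H
  SameLeftCoset : ∀ {p} → Pred Carrier p → Carrier → Carrier → Set p
  SameLeftCoset H x y = x ⁻¹ ∙ y ∈ H

  -- |G : H| ≤ k, i.e. there are at most k left cosets: among any k + 1
  -- elements, two (at distinct positions) represent the same coset.
  -- Constructively this is implied by the existence of k coset
  -- representatives, see `representatives⇒IndexAtMost`.
  IndexAtMost : ∀ {p} → Pred Carrier p → ℕ → Set (c ⊔ p)
  IndexAtMost H k = (f : Fin (suc k) → Carrier) →
                    ∃₂ λ i j → i ≢ j × SameLeftCoset H (f i) (f j)

  _·ˡ_ : ∀ {p} → Carrier → Pred Carrier p → Pred Carrier (c ⊔ ℓ ⊔ p)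
  (a ·ˡ X) y = ∃ λ x → x ∈ X × y ≈ a ∙ x

  -- X is k-large in the subgroup H of G; intended for X ⊆ H.  The family a
  -- may have repetitions.  Requiring y ∈ H only matters when k = 0, where
  -- the empty intersection is taken to be H.
  Large : ∀ {p q} → Pred Carrier p → ℕ → Pred Carrier q → Set (c ⊔ ℓ ⊔ p ⊔ q)
  Large H k X = (a : Fin k → Carrier) → (∀ i → a i ∈ H) →
                ∃ λ y → y ∈ H × (∀ i → y ∈ (a i ·ˡ X))

module _ {c ℓ p : Level} (G : Group c ℓ) {H : Pred (Group.Carrier G) p}
         (isSubgroup : IsSubgroup G H) where
  open Group G
  open IsSubgroup isSubgroup
  open import Algebra.Properties.Group G using (⁻¹-anti-homo-∙)
  open import Relation.Binary.Reasoning.Setoid setoid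

  representatives⇒IndexAtMost : ∀ {k} (t : Fin k → Carrier) →
    (∀ x → ∃ λ i → SameLeftCoset G H (t i) x) → IndexAtMost G H k
  representatives⇒IndexAtMost {k} t cover f
    with pigeonhole (n<1+n k) (λ i → proj₁ (cover (f i)))
  ... | i , j , i<j , eq = i , j , <⇒≢ i<j ,
    respects cancel (∙-closed (⁻¹-closed (proj₂ (cover (f i)))) f[j]∈)
    where
    u = t (proj₁ (cover (f i)))

    f[j]∈ : SameLeftCoset G H u (f j)
    f[j]∈ = subst (λ l → SameLeftCoset G H (t l) (f j)) (≡.sym eq) (proj₂ (cover (f j)))

    cancel : (u ⁻¹ ∙ f i) ⁻¹ ∙ (u ⁻¹ ∙ f j) ≈ f i ⁻¹ ∙ f j
    cancel = begin
      (u ⁻¹ ∙ f i) ⁻¹ ∙ (u ⁻¹ ∙ f j)       ≈⟨ ∙-congʳ (⁻¹-anti-homo-∙ _ _) ⟩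
      (f i ⁻¹ ∙ u ⁻¹ ⁻¹) ∙ (u ⁻¹ ∙ f j)    ≈⟨ assoc _ _ _ ⟩
      f i ⁻¹ ∙ (u ⁻¹ ⁻¹ ∙ (u ⁻¹ ∙ f j))    ≈⟨ ∙-congˡ (assoc _ _ _) ⟨
      f i ⁻¹ ∙ ((u ⁻¹ ⁻¹ ∙ u ⁻¹) ∙ f j)    ≈⟨ ∙-congˡ (∙-congʳ (inverseˡ _)) ⟩
      f i ⁻¹ ∙ (ε ∙ f j)                   ≈⟨ ∙-congˡ (identityˡ _) ⟩
      f i ⁻¹ ∙ f j                         ∎

-- The direct power, with carrier Fin n → Carrier and pointwise equality.
_^ᵍ_ : ∀ {c ℓ} → Group c ℓ → ℕ → Group c ℓ
G ^ᵍ n = Pointwise.group (Fin n) G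

-- Group words in x₁,…,xₙ (inj₁) and y₁,…,yₘ (inj₂): finite, not necessarily
-- reduced, sequences of variables (sign +) and their inverses (sign -).
Word : ℕ → ℕ → Set
Word n m = List (Sign × (Fin n ⊎ Fin m))

module _ {c ℓ : Level} (G : Group c ℓ) where
  open Group G

  _^ˢ_ : Carrier → Sign → Carrier
  x ^ˢ Sign.+ = x
  x ^ˢ Sign.- = x ⁻¹

  eval : ∀ {n m} → Word n m → (Fin n → Carrier) → (Fin m → Carrier) → Carrier
  eval w h g = foldr (λ (s , v) r → ([ h , g ] v ^ˢ s) ∙ r) ε w

{-# OPTIONS --safe #-}

-- Let N consist of the x ∈ G all of whose coordinates commute with every hⱼ
-- and gⱼ; it has index at most K = k^(n²+mn), and w(h x, g) = w(h, g) w(x, 1)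
-- and w(x, g) = w(1, g) w(x, 1) for x ∈ N.  A K-large set meets every subgroup
-- of index at most K; applied to X ∩ h⁻¹X, which is K-large since the solution
-- set X is 2K-large, this gives x ∈ N with w(x, g) = c = w(h x, g).  Hence
-- w(h, g) = w(1, g) for all h ∈ G, and this common value is c since X ≠ ∅.
--
-- Neither membership in N nor equality in G₁ is decidable, so no coset
-- representatives are available.  That N has index at most K is proved by
-- colouring finite families so that equal colours imply equal cosets.  To meet
-- N in a K-large set X, largeness yields successively a₀, …, a_K with
-- aⱼ ∈ aᵢX for all i < j; some aᵢ, aⱼ with i < j lie in the same coset of N,
-- and then aᵢ⁻¹aⱼ ∈ N ∩ X.
module Submission where

open import Defs
open import Algebra.Bundles using (Group)
import Algebra.Properties.Group as GroupProperties
open import Data.Fin as Fin using (Fin; zero; suc; _≟_; combine; remQuot; inject≤; join; splitAt;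
  punchIn; punchOut; _↑ˡ_)
open import Data.Fin.Properties using (combine-injective; remQuot-combine; inject≤-injective;
  punchIn-punchOut; pigeonhole; <⇒≢; <-cmp; splitAt-join; splitAt-↑ˡ)
open import Data.List using ([]; _∷_)
open import Data.Nat using (ℕ; zero; suc; _+_; _*_; _^_; _≤_; _≤?_; s≤s; s<s⁻¹)
open import Data.Nat.Properties using (≰⇒>; n<1+n; m≤n⇒m≤1+n; m≤n⇒∃[o]m+o≡n; ≤-refl; ^-*-assoc;
  *-distribʳ-+; *-identityʳ)
open import Data.Product using (_×_; _,_; proj₁; proj₂; ∃; ∃₂)
open import Data.Sign using (Sign)
open import Data.Sum using (_⊎_; inj₁; inj₂; [_,_])
open import Data.Vec.Functional using () renaming ([] to []ᶠ; _∷_ to _◂_)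
open import Function using (_∘_; _on_)
open import Level using (Level; _⊔_)
open import Relation.Binary.Core using (Rel)
open import Relation.Binary.Definitions using (Tri; tri<; tri≈; tri>)
open import Relation.Binary.PropositionalEquality as ≡ using (_≡_; _≢_; subst)
open import Relation.Binary.Structures using (IsEquivalence)
import Relation.Binary.Reasoning.Setoid as SetoidReasoning
open import Relation.Nullary using (yes; no; contradiction)
open import Relation.Unary using (Pred; _∈_)

-- Colourings of finite families

private variable
  a b c ℓ p q : Level
  A B : Set a

-- A positive form of having at most `k` classes. Bounds multiply when relations are intersected,
-- because colours can be paired.
Colourable : {A : Set a} → Rel A ℓ → ℕ → Set (a ⊔ ℓ)
Colourable {A = A} R k = ∀ {r} (t : Fin r → A) →
  ∃ λ (col : Fin r → Fin k) → ∀ {i j} → col i ≡ col j → R (t i) (t j)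

Colourable-on : {R : Rel B ℓ} {k : ℕ} (f : A → B) → Colourable R k → Colourable (R on f) k
Colourable-on f colour t = colour (f ∘ t)

Colourable-∀ : {A : Set a} {k : ℕ} (r : ℕ) {R : Fin r → Rel A ℓ} →
  (∀ v → Colourable (R v) k) → Colourable (λ x y → ∀ v → R v x y) (k ^ r)
Colourable-∀ zero    colour t = (λ _ → zero) , λ _ ()
Colourable-∀ {k = k} (suc r) {R} colour {s} t
  with colour zero t | Colourable-∀ r {R = R ∘ suc} (λ v → colour (suc v)) t
... | col₀ , sound₀ | col₁ , sound₁ = (λ i → combine (col₀ i) (col₁ i)) , sound
  where
  sound : ∀ {i j} → combine (col₀ i) (col₁ i) ≡ combine (col₀ j) (col₁ j) →
          ∀ v → R v (t i) (t j)
  sound {i} {j} eq with combine-injective (col₀ i) (col₁ i) (col₀ j) (col₁ j) eq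
  ... | eq₀ , eq₁ = λ { zero → sound₀ eq₀ ; (suc v) → sound₁ eq₁ v }

module _ {A : Set a} {R : Rel A ℓ} (isEquivalence : IsEquivalence R) {k : ℕ}
         (collide : (f : Fin (suc k) → A) → ∃₂ λ i j → i ≢ j × R (f i) (f j)) where
  module R = IsEquivalence isEquivalence

  -- While more than k elements remain, one of them is equivalent to another and
  -- can be dropped, taking over the colour of the other in the end.
  collisions⇒Colourable : Colourable R k
  collisions⇒Colourable {zero}  t = (λ ()) , λ { {()} }
  collisions⇒Colourable {suc r} t with suc r ≤? k
  ... | yes r<k = (λ i → inject≤ i r<k) ,
    λ eq → R.reflexive (≡.cong t (inject≤-injective r<k r<k _ _ eq))
  -- The first `k + 1` elements already contain a collision; `j` is the index to be dropped.
  ... | no r≮k with collide (λ i → t (inject≤ i (≰⇒> r≮k)))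
  ... | i′ , j′ , i′≢j′ , Rij with collisions⇒Colourable (t ∘ punchIn (inject≤ j′ (≰⇒> r≮k)))
  ... | col , sound = (λ l → col (proj₁ (merge l))) ,
    λ {l} {l′} eq → R.trans (proj₂ (merge l)) (R.trans (sound eq) (R.sym (proj₂ (merge l′))))
    where
    i j : Fin (suc r)
    i = inject≤ i′ (≰⇒> r≮k)
    j = inject≤ j′ (≰⇒> r≮k)

    j≢i : j ≢ i
    j≢i j≡i = i′≢j′ (inject≤-injective _ _ _ _ (≡.sym j≡i))

    merge : ∀ l → ∃ λ l′ → R (t l) (t (punchIn j l′))
    merge l with j ≟ l
    ... | yes ≡.refl = punchOut j≢i ,
      R.trans (R.sym Rij) (R.reflexive (≡.cong t (≡.sym (punchIn-punchOut j≢i))))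
    ... | no j≢l   = punchOut j≢l , R.reflexive (≡.cong t (≡.sym (punchIn-punchOut j≢l)))

-- Cosets and large sets

module _ (G : Group c ℓ) where
  open Group G
  open GroupProperties G
  open SetoidReasoning setoid

  module _ {H : Pred Carrier p} (isSubgroup : IsSubgroup G H) where
    open IsSubgroup isSubgroup

    SameLeftCoset-isEquivalence : IsEquivalence (SameLeftCoset G H)
    SameLeftCoset-isEquivalence = record
      { refl  = λ {x} → respects (sym (inverseˡ x)) ε-closed
      ; sym   = λ {x} {y} xy → respects (⁻¹-anti-homo-\\ x y) (⁻¹-closed xy)
      ; trans = λ {x} {y} {z} xy yz → respects
          (trans (assoc _ _ _) (∙-congˡ (\\-leftDividesˡ y z)))
          (∙-closed xy yz)
      }

    IndexAtMost⇒Colourable : ∀ {k} → IndexAtMost G H k → Colourable (SameLeftCoset G H) k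
    IndexAtMost⇒Colourable = collisions⇒Colourable SameLeftCoset-isEquivalence

  Colourable⇒IndexAtMost : ∀ {H : Pred Carrier p} {k} →
    Colourable (SameLeftCoset G H) k → IndexAtMost G H k
  Colourable⇒IndexAtMost {k = k} colour f with colour f
  ... | col , sound with pigeonhole (n<1+n k) col
  ... | i , j , i<j , eq = i , j , <⇒≢ i<j , sound eq

  Centralizer-isSubgroup : ∀ z → IsSubgroup G (Centralizer G z)
  Centralizer-isSubgroup z = record
    { respects  = λ x≈y xz → trans (∙-congʳ (sym x≈y)) (trans xz (∙-congˡ x≈y))
    ; ε-closed  = trans (identityˡ z) (sym (identityʳ z))
    ; ∙-closed  = λ {x} {y} xz yz → begin
        (x ∙ y) ∙ z ≈⟨ assoc x y z ⟩
        x ∙ (y ∙ z) ≈⟨ ∙-congˡ yz ⟩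
        x ∙ (z ∙ y) ≈⟨ assoc x z y ⟨
        (x ∙ z) ∙ y ≈⟨ ∙-congʳ xz ⟩
        (z ∙ x) ∙ y ≈⟨ assoc z x y ⟩
        z ∙ (x ∙ y) ∎
    ; ⁻¹-closed = λ {x} xz → begin
        x ⁻¹ ∙ z                 ≈⟨ ∙-congˡ (//-rightDividesʳ x z) ⟨
        x ⁻¹ ∙ ((z ∙ x) ∙ x ⁻¹)  ≈⟨ ∙-congˡ (∙-congʳ xz) ⟨
        x ⁻¹ ∙ ((x ∙ z) ∙ x ⁻¹)  ≈⟨ ∙-congˡ (assoc x z (x ⁻¹)) ⟩
        x ⁻¹ ∙ (x ∙ (z ∙ x ⁻¹))  ≈⟨ \\-leftDividesʳ x (z ∙ x ⁻¹) ⟩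
        z ∙ x ⁻¹                 ∎
    }

  module _ {H : Pred Carrier p} (H-isSubgroup : IsSubgroup G H) where
    private module H = IsSubgroup H-isSubgroup

    -- Translating the intersection of all `bₛX` by `aᵢ` gives the intersection of all `aᵢbₛX`, so
    -- `k` of its translates amount to `r * k` translates of `X`.
    Large-translates : ∀ {X : Pred Carrier q} {r k} (b : Fin r → Carrier) → (∀ s → b s ∈ H) →
      Large G H (r * k) X → Large G H k (λ x → ∀ s → x ∈ _·ˡ_ G (b s) X)
    Large-translates {X = X} {r} {k} b b∈H large a a∈H
      with large (λ l → let (s , i) = remQuot {r} k l in a i ∙ b s)
                 (λ l → let (s , i) = remQuot {r} k l in H.∙-closed (a∈H i) (b∈H s))
    ... | y , y∈H , y∈ = y , y∈H ,
      λ i → a i \\ y , (λ s → translate i s (y∈′ i s)) , sym (\\-leftDividesˡ (a i) y)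
      where
      y∈′ : ∀ i s → y ∈ _·ˡ_ G (a i ∙ b s) X
      y∈′ i s = subst (λ (s′ , i′) → y ∈ _·ˡ_ G (a i′ ∙ b s′) X)
                      (remQuot-combine s i) (y∈ (combine s i))

      translate : ∀ i s → y ∈ _·ˡ_ G (a i ∙ b s) X → (a i \\ y) ∈ _·ˡ_ G (b s) X
      translate i s (x , x∈X , y≈) = x , x∈X , (begin
        a i \\ y                  ≈⟨ ∙-congˡ y≈ ⟩
        a i \\ ((a i ∙ b s) ∙ x)  ≈⟨ ∙-congˡ (assoc _ _ _) ⟩
        a i \\ (a i ∙ (b s ∙ x))  ≈⟨ \\-leftDividesʳ _ _ ⟩
        b s ∙ x                   ∎)

    -- The family of translating elements is padded with `ε`.
    Large-≤ : ∀ {X : Pred Carrier q} {j k} → j ≤ k → Large G H k X → Large G H j X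
    Large-≤ {X = X} {j} j≤k large a a∈H with m≤n⇒∃[o]m+o≡n j≤k
    ... | o , ≡.refl with large (pad ∘ splitAt j) (pad∈H ∘ splitAt j)
      where
      pad : Fin j ⊎ Fin o → Carrier
      pad = [ a , (λ _ → ε) ]

      pad∈H : ∀ v → pad v ∈ H
      pad∈H (inj₁ i) = a∈H i
      pad∈H (inj₂ _) = H.ε-closed
    ... | y , y∈H , y∈ = y , y∈H , λ i →
      subst (λ v → y ∈ _·ˡ_ G ([ a , (λ _ → ε) ] v) X) (splitAt-↑ˡ j i o) (y∈ (i ↑ˡ o))

    -- In reverse order of construction: new elements are prepended.
    Large⇒chain : ∀ {X : Pred Carrier q} {k} → Large G H k X → ∀ r → r ≤ suc k →
      ∃ λ (f : Fin r → Carrier) → (∀ i → f i ∈ H) ×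
        (∀ {i j} → i Fin.< j → f i ∈ _·ˡ_ G (f j) X)
    Large⇒chain large zero _ = (λ ()) , (λ ()) , λ { {()} }
    Large⇒chain {X = X} large (suc r) (s≤s r≤k) with Large⇒chain large r (m≤n⇒m≤1+n r≤k)
    -- The next element has to lie in only `r ≤ k` translates, so the chain can reach length
    -- `k + 1`.
    ... | f , f∈H , chain with Large-≤ r≤k large f f∈H
    ... | y , y∈H , y∈ = y ◂ f , (λ { zero → y∈H ; (suc i) → f∈H i }) , chain′
      where
      chain′ : ∀ {i j} → i Fin.< j → (y ◂ f) i ∈ _·ˡ_ G ((y ◂ f) j) X
      chain′ {zero}  {suc j} _   = y∈ j
      chain′ {suc i} {suc j} i<j = chain (s<s⁻¹ i<j)

    Large-meets : ∀ {N : Pred Carrier b} {X : Pred Carrier q} {k} → IsSubgroup G N →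
      IndexAtMost G N k → Large G H k X → ∃ λ x → x ∈ N × x ∈ X
    Large-meets {N = N} {X} {k} N-isSubgroup index large with Large⇒chain large (suc k) ≤-refl
    ... | f , _ , chain with index f
    ... | i , j , i≢j , ij = conclude (<-cmp i j)
      where
      module N = IsSubgroup N-isSubgroup

      quotient : ∀ {x y} → SameLeftCoset G N x y → y ∈ _·ˡ_ G x X → ∃ λ z → z ∈ N × z ∈ X
      quotient {x} xy (z , z∈X , y≈xz) =
        z , N.respects (trans (∙-congˡ y≈xz) (\\-leftDividesʳ x z)) xy , z∈X

      conclude : Tri (i Fin.< j) (i ≡ j) (j Fin.< i) → ∃ λ z → z ∈ N × z ∈ X
      -- Smaller indices are later elements: here `f i ∈ f j X`, and the quotient is
      -- `(f j)⁻¹ ∙ f i`.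
      conclude (tri< i<j _ _) =
        quotient (IsEquivalence.sym (SameLeftCoset-isEquivalence N-isSubgroup) ij) (chain i<j)
      conclude (tri≈ _ i≡j _) = contradiction i≡j i≢j
      conclude (tri> _ _ j<i) = quotient ij (chain j<i)

-- Common centralizers and word evaluation

module _ (G : Group c ℓ) where
  open Group G
  open GroupProperties G
  open SetoidReasoning setoid

  -- With `u` listing the coordinates of h and g, this is the subgroup N.
  CommonCentralizer : ∀ {n r} → (Fin r → Carrier) → Pred (Fin n → Carrier) ℓ
  CommonCentralizer u x = ∀ i v → x i ∈ Centralizer G (u v)

  CommonCentralizer-isSubgroup : ∀ {n r} (u : Fin r → Carrier) →
    IsSubgroup (G ^ᵍ n) (CommonCentralizer u)
  CommonCentralizer-isSubgroup u = record
    { respects  = λ x≈y x∈ i v → C.respects v (x≈y i) (x∈ i v)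
    ; ε-closed  = λ i v → C.ε-closed v
    ; ∙-closed  = λ x∈ y∈ i v → C.∙-closed v (x∈ i v) (y∈ i v)
    ; ⁻¹-closed = λ x∈ i v → C.⁻¹-closed v (x∈ i v)
    }
    where module C v = IsSubgroup (Centralizer-isSubgroup G (u v))

  -- There is one centralizer condition for each of the `n` coordinates and `r` entries of `u`, and
  -- each contributes a factor `k` to the number of colours.
  CommonCentralizer-index : ∀ {k} → (∀ z → IndexAtMost G (Centralizer G z) k) →
    ∀ n {r} (u : Fin r → Carrier) → IndexAtMost (G ^ᵍ n) (CommonCentralizer u) ((k ^ r) ^ n)
  CommonCentralizer-index index n {r} u =
    Colourable⇒IndexAtMost (G ^ᵍ n) {H = CommonCentralizer u}
      (Colourable-∀ n {R = λ i x y → ∀ v → Coset v (x i) (y i)} λ i →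
        Colourable-on {R = λ x y → ∀ v → Coset v x y} (λ x → x i)
          (Colourable-∀ r {R = Coset} λ v →
            IndexAtMost⇒Colourable G (Centralizer-isSubgroup G (u v)) (index (u v))))
    where
    Coset : Fin r → Rel Carrier ℓ
    Coset v = SameLeftCoset G (Centralizer G (u v))

  ^ˢ-cong : ∀ s {x y} → x ≈ y → _^ˢ_ G x s ≈ _^ˢ_ G y s
  ^ˢ-cong Sign.+ x≈y = x≈y
  ^ˢ-cong Sign.- x≈y = ⁻¹-cong x≈y

  ^ˢ-closed : ∀ {H : Pred Carrier p} → IsSubgroup G H → ∀ s {x} → x ∈ H → _^ˢ_ G x s ∈ H
  ^ˢ-closed H Sign.+ x∈H = x∈H
  ^ˢ-closed H Sign.- x∈H = IsSubgroup.⁻¹-closed H x∈H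

  ^ˢ-distrib-∙ : ∀ s {x y} → x ∈ Centralizer G y → _^ˢ_ G (x ∙ y) s ≈ _^ˢ_ G x s ∙ _^ˢ_ G y s
  ^ˢ-distrib-∙ Sign.+         _  = refl
  ^ˢ-distrib-∙ Sign.- {x} {y} xy = trans (⁻¹-cong xy) (⁻¹-anti-homo-∙ y x)

  module _ {n m : ℕ} where

    eval-congˡ : ∀ (w : Word n m) {h h′} g → (∀ i → h i ≈ h′ i) → eval G w h g ≈ eval G w h′ g
    eval-congˡ []                 g h≈h′ = refl
    eval-congˡ ((s , inj₁ i) ∷ w) g h≈h′ = ∙-cong (^ˢ-cong s (h≈h′ i)) (eval-congˡ w g h≈h′)
    eval-congˡ ((s , inj₂ j) ∷ w) g h≈h′ = ∙-congˡ (eval-congˡ w g h≈h′)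

    eval-closed : ∀ {H : Pred Carrier p} → IsSubgroup G H → ∀ (w : Word n m) {h g} →
      (∀ v → [ h , g ] v ∈ H) → eval G w h g ∈ H
    eval-closed H []            _  = IsSubgroup.ε-closed H
    eval-closed H ((s , v) ∷ w) hg =
      IsSubgroup.∙-closed H (^ˢ-closed H s (hg v)) (eval-closed H w hg)

    -- Each letter splits into an (h, g)-part and an (x, 1)-part. The latter moves right past the
    -- remaining (h, g)-letters, which commute with it; the x-letters keep their order, as they may
    -- not commute with each other.
    eval-∙ : ∀ (w : Word n m) {h x g} → (∀ i v → [ h , g ] v ∈ Centralizer G (x i)) →
      eval G w (λ i → h i ∙ x i) g ≈ eval G w h g ∙ eval G w x (λ _ → ε)
    eval-∙ []            _    = sym (identityˡ ε)
    eval-∙ ((s , v) ∷ w) {h} {x} {g} comm = begin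
      _^ˢ_ G ([ h∙x , g ] v) s ∙ eval G w h∙x g  ≈⟨ ∙-cong (^ˢ-cong s (letter v)) (eval-∙ w comm) ⟩
      _^ˢ_ G (y ∙ z) s ∙ (U ∙ V)                 ≈⟨ ∙-congʳ (^ˢ-distrib-∙ s (commutes v v)) ⟩
      (yˢ ∙ zˢ) ∙ (U ∙ V)                        ≈⟨ assoc _ _ _ ⟩
      yˢ ∙ (zˢ ∙ (U ∙ V))                        ≈⟨ ∙-congˡ (assoc _ _ _) ⟨
      yˢ ∙ ((zˢ ∙ U) ∙ V)                        ≈⟨ ∙-congˡ (∙-congʳ zˢU) ⟩
      yˢ ∙ ((U ∙ zˢ) ∙ V)                        ≈⟨ ∙-congˡ (assoc _ _ _) ⟩
      yˢ ∙ (U ∙ (zˢ ∙ V))                        ≈⟨ assoc _ _ _ ⟨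
      (yˢ ∙ U) ∙ (zˢ ∙ V)                        ∎
      where
      h∙x = λ i → h i ∙ x i
      y = [ h , g ] v
      z = [ x , (λ _ → ε) ] v
      yˢ = _^ˢ_ G y s
      zˢ = _^ˢ_ G z s
      U = eval G w h g
      V = eval G w x (λ _ → ε)

      letter : ∀ v → [ h∙x , g ] v ≈ [ h , g ] v ∙ [ x , (λ _ → ε) ] v
      letter (inj₁ i) = refl
      letter (inj₂ j) = sym (identityʳ (g j))

      commutes : ∀ v v′ → [ h , g ] v ∈ Centralizer G ([ x , (λ _ → ε) ] v′)
      commutes v (inj₁ i) = comm i v
      commutes v (inj₂ j) = trans (identityʳ _) (sym (identityˡ _))

      zˢU : zˢ ∙ U ≈ U ∙ zˢ
      -- All letters of `U` centralize `z`, hence so does `U`; then the centralizer of `U` contains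
      -- `z` and so `zˢ`.
      zˢU = ^ˢ-closed (Centralizer-isSubgroup G U) s
        (sym (eval-closed (Centralizer-isSubgroup G z) w (λ v′ → commutes v′ v)))

-- From large solution sets to identities

theorem3p3 : {ℓ₁ ℓ₂ ℓ₃ : Level} (G₁ : Group ℓ₁ ℓ₂) (let open Group G₁)
    (k : ℕ) → 1 ≤ k →
    (∀ (a : Carrier) → IndexAtMost G₁ (Centralizer G₁ a) k) →
    (n m : ℕ)
    (G : Pred (Group.Carrier (G₁ ^ᵍ n)) ℓ₃) → IsSubgroup (G₁ ^ᵍ n) G →
    (w : Word n m) (g : Group.Carrier (G₁ ^ᵍ m)) (c : Carrier) →
    Large (G₁ ^ᵍ n) G (2 * k ^ (n ^ 2 + m * n)) (λ h → h ∈ G × eval G₁ w h g ≈ c) →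
    ∀ (h : Group.Carrier (G₁ ^ᵍ n)) → h ∈ G → eval G₁ w h g ≈ c
theorem3p3 G₁ k _ index n m G G-isSubgroup w g c large h h∈G = conclude (solution h∈G)
  where
  open Group G₁
  open GroupProperties G₁ using (∙-cancelʳ; \\-leftDividesˡ)
  open SetoidReasoning setoid
  module Gⁿ = Group (G₁ ^ᵍ n)
  module G = IsSubgroup G-isSubgroup

  ⟦_⟧ : Gⁿ.Carrier → Carrier
  ⟦ h ⟧ = eval G₁ w h g

  Solution : Pred Gⁿ.Carrier _
  Solution x = x ∈ G × ⟦ x ⟧ ≈ c

  K : ℕ
  K = k ^ (n ^ 2 + m * n)

  exponent : (k ^ (n + m)) ^ n ≡ K
  exponent = ≡.trans (^-*-assoc k (n + m) n) (≡.cong (k ^_) (≡.trans (*-distribʳ-+ n n m)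
    -- `n ^ 2` computes to `n * (n * 1)`.
    (≡.cong (λ l → n * l + m * n) (≡.sym (*-identityʳ n)))))

  _∈ˡ_·Solution : Gⁿ.Carrier → Gⁿ.Carrier → Set _
  x ∈ˡ b ·Solution = x ∈ _·ˡ_ (G₁ ^ᵍ n) b Solution

  meet : ∀ {h} → h ∈ G → ∃ λ x → x ∈ CommonCentralizer G₁ ([ h , g ] ∘ splitAt n) ×
    (∀ s → x ∈ˡ (Gⁿ.ε ◂ h Gⁿ.⁻¹ ◂ []ᶠ) s ·Solution)
  meet {h} h∈G = Large-meets (G₁ ^ᵍ n) G-isSubgroup
    (CommonCentralizer-isSubgroup G₁ u)
    (subst (IndexAtMost (G₁ ^ᵍ n) (CommonCentralizer G₁ u)) exponent
      (CommonCentralizer-index G₁ index n u))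
    -- The factor 2 in the largeness pays for the two translates, by `ε` and by `h⁻¹`.
    (Large-translates (G₁ ^ᵍ n) G-isSubgroup {X = Solution} {2} {K} (Gⁿ.ε ◂ h Gⁿ.⁻¹ ◂ []ᶠ)
      (λ { zero → G.ε-closed ; (suc zero) → G.⁻¹-closed h∈G }) large)
    where
    u : Fin (n + m) → Carrier
    u = [ h , g ] ∘ splitAt n

  -- Both `x` and `h ∙ x` are solutions; splitting off w(x, 1) from each by `eval-∙` and cancelling
  -- it leaves the claim.
  compare : ∀ {h x} → x ∈ CommonCentralizer G₁ ([ h , g ] ∘ splitAt n) →
    x ∈ˡ Gⁿ.ε ·Solution → x ∈ˡ h Gⁿ.⁻¹ ·Solution → ⟦ h ⟧ ≈ ⟦ Gⁿ.ε ⟧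
  compare {h} {x} x∈N (x₀ , sol₀ , x≈εx₀) (x₁ , sol₁ , x≈h⁻¹x₁) = ∙-cancelʳ w[x,1] _ _ (begin
    ⟦ h ⟧ ∙ w[x,1]     ≈⟨ eval-∙ G₁ w comm ⟨
    ⟦ h Gⁿ.∙ x ⟧       ≈⟨ eval-congˡ G₁ w g hx≈x₁ ⟩
    ⟦ x₁ ⟧             ≈⟨ proj₂ sol₁ ⟩
    c                  ≈⟨ proj₂ sol₀ ⟨
    ⟦ x₀ ⟧             ≈⟨ eval-congˡ G₁ w g εx≈x₀ ⟨
    ⟦ Gⁿ.ε Gⁿ.∙ x ⟧    ≈⟨ eval-∙ G₁ w commε ⟩
    ⟦ Gⁿ.ε ⟧ ∙ w[x,1]  ∎)
    where
    w[x,1] : Carrier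
    w[x,1] = eval G₁ w x (λ _ → ε)

    hx≈x₁ : (h Gⁿ.∙ x) Gⁿ.≈ x₁
    hx≈x₁ i = trans (∙-congˡ (x≈h⁻¹x₁ i)) (\\-leftDividesˡ (h i) (x₁ i))

    εx≈x₀ : (Gⁿ.ε Gⁿ.∙ x) Gⁿ.≈ x₀
    εx≈x₀ i = trans (identityˡ (x i)) (trans (x≈εx₀ i) (identityˡ (x₀ i)))

    comm : ∀ i v → [ h , g ] v ∈ Centralizer G₁ (x i)
    comm i v = subst (λ v′ → [ h , g ] v′ ∈ Centralizer G₁ (x i)) (splitAt-join n m v)
      (sym (x∈N i (join n m v)))

    commε : ∀ i v → [ Gⁿ.ε , g ] v ∈ Centralizer G₁ (x i)
    commε i (inj₁ _) = trans (identityˡ (x i)) (sym (identityʳ (x i)))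
    commε i (inj₂ j) = comm i (inj₂ j)

  -- A solution is returned as well, in order to identify the common value with `c`.
  solution : ∀ {h} → h ∈ G → ∃ λ x → Solution x × ⟦ h ⟧ ≈ ⟦ Gⁿ.ε ⟧
  solution h∈G =
    let (_ , x∈N , x∈) = meet h∈G
        (x₀ , sol₀ , _) = x∈ zero
    in x₀ , sol₀ , compare x∈N (x∈ zero) (x∈ (suc zero))

  conclude : (∃ λ x → Solution x × ⟦ h ⟧ ≈ ⟦ Gⁿ.ε ⟧) → ⟦ h ⟧ ≈ c
  conclude (x , (x∈G , wx≈c) , wh≈wε) =
    -- `solution` is applied again, now to the solution `x` itself, which shows that the value at
    -- `ε` is `c`.
    trans wh≈wε (trans (sym (proj₂ (proj₂ (solution x∈G)))) wx≈c)
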